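{- Let $\mathbb{K}$ be a field and $s\geq 3$ an integer. Let $f=\sum_{i=0}^n a_ix_s^i\in\mathbb{K}[x_1,\ldots,x_s]$ with $n\geq 2$, $a_0,\ldots,a_n\in\mathbb{K}[x_1,\ldots,x_{s-1}]$, $a_0a_n\neq 0$. Assume that $f$ has no nonconstant factor in $\mathbb{K}[x_1,\ldots,x_{s-1}]$. If there exists an index $j$ with $0\leq j\leq n-1$ such that $$\deg_{s-1}a_j>\max_{i\neq j}\{\deg_{s-1}a_i+(j-i)\deg_{s-1}a_n\},$$ then $f$ is a product of at most $n-j$ irreducible polynomials over $\mathbb{K}[x_1,\ldots,x_{s-1}]$. In particular, if $j=n-1$, then $f$ is irreducible over $\mathbb{K}[x_1,\ldots,x_{s-1}]$.
   Context: For a polynomial $g\in\mathbb{K}[x_1,\ldots,x_r]$, $\deg_r g$ denotes the degree of $g$ viewed as a polynomial in $x_r$ with coefficients in $\mathbb{K}[x_1,\ldots,x_{r-1}]$. $f$ is regarded as a polynomial in $x_s$ with coefficients in $\mathbb{K}[x_1,\ldots,x_{s-1}]$, and "a product of at most $k$ irreducible polynomials over $\mathbb{K}[x_1,\ldots,x_{s-1}]$" means that its factorization into irreducibles of $\mathbb{K}[x_1,\ldots,x_{s-1}][x_s]$ has at most $k$ factors counted with multiplicities. -}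

module Defs where

open import Level using (_⊔_; lift; lower)
open import Algebra.Apartness using (HeytingField; HeytingCommutativeRing)
open import Algebra.Bundles using (CommutativeRing; Semiring)
import Algebra.Definitions.RawSemiring as RawSemiringDefinitions
import Algebra.Properties.CommutativeSemigroup as CommutativeSemigroupProperties
import Algebra.Properties.Ring as RingProperties
open import Axiom.ExcludedMiddle using (ExcludedMiddle)
open import Data.Fin.Base using (Fin)
import Data.Fin.Properties as Fin
open import Data.Integer.Base as ℤ using (ℤ)
import Data.Integer.Properties as ℤ
import Data.List.Extrema as Extrema
open import Data.List.Base using (List; []; _∷_; map; filter; allFin)
open import Data.Nat.Base as ℕ using (ℕ; zero; suc)
open import Data.Product.Base using (Σ-syntax; ∃-syntax; _×_; _,_)
open import Data.Vec.Functional using (Vector)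
open import Relation.Binary.Bundles using (Setoid; TotalOrder)
import Relation.Binary.Construct.Add.Infimum.NonStrict as AddInfimum
open import Relation.Binary.Definitions using (Decidable)
open import Relation.Binary.Structures using (IsEquivalence)
import Relation.Binary.Reasoning.Setoid as SetoidReasoning
open import Relation.Nullary.Construct.Add.Infimum using (_₋; ⊥₋; [_])
open import Relation.Nullary.Decidable using (Dec; yes; no; map′; ¬?)

-- Univariate polynomials, as lists of coefficients with the constant
-- coefficient first; trailing zeros are allowed and are invisible to _≈_.

module Polynomial {c ℓ} (R : CommutativeRing c ℓ) where

  private
    module R = CommutativeRing R
    module RP = RingProperties R.ring
    module +-CSG = CommutativeSemigroupProperties R.+-commutativeSemigroup
    module R-Reasoning = SetoidReasoning R.setoid

  infix  8 -_
  infixr 7 _·_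
  infixl 7 _*_
  infixl 6 _+_
  infix  4 _≈_

  Carrier : Set c
  Carrier = List R.Carrier

  coeff : Carrier → ℕ → R.Carrier
  coeff []      _       = R.0#
  coeff (a ∷ p) zero    = a
  coeff (a ∷ p) (suc i) = coeff p i

  record _≈_ (p q : Carrier) : Set ℓ where
    constructor coeffwise
    field at : ∀ i → coeff p i R.≈ coeff q i

  open _≈_ public

  0# : Carrier
  0# = []

  C : R.Carrier → Carrier
  C a = a ∷ []

  1# : Carrier
  1# = C R.1#

  X : Carrier
  X = R.0# ∷ 1#

  _+_ : Carrier → Carrier → Carrier
  []      + q       = q
  (a ∷ p) + []      = a ∷ p
  (a ∷ p) + (b ∷ q) = a R.+ b ∷ p + q

  -_ : Carrier → Carrier
  -_ = map (λ a → R.- a)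

  _·_ : R.Carrier → Carrier → Carrier
  a · p = map (a R.*_) p

  _*_ : Carrier → Carrier → Carrier
  []      * q = []
  (a ∷ p) * q = a · q + (R.0# ∷ p * q)

  degree : Decidable R._≈_ → Carrier → ℤ ₋
  degree _≟_ [] = ⊥₋
  degree _≟_ (a ∷ p) with degree _≟_ p
  ... | [ d ] = [ ℤ.suc d ]
  ... | ⊥₋ with a ≟ R.0#
  ...   | yes _ = ⊥₋
  ...   | no  _ = [ ℤ.0ℤ ]

  ≈-refl : ∀ {p} → p ≈ p
  ≈-refl .at i = R.refl

  ≈-sym : ∀ {p q} → p ≈ q → q ≈ p
  ≈-sym e .at i = R.sym (e .at i)

  ≈-trans : ∀ {p q r} → p ≈ q → q ≈ r → p ≈ r
  ≈-trans e e′ .at i = R.trans (e .at i) (e′ .at i)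

  ≈-isEquivalence : IsEquivalence _≈_
  ≈-isEquivalence = record { refl = ≈-refl ; sym = ≈-sym ; trans = ≈-trans }

  setoid : Setoid c ℓ
  setoid = record { isEquivalence = ≈-isEquivalence }

  private
    module P-Reasoning = SetoidReasoning setoid

  ∷-cong : ∀ {a b p q} → a R.≈ b → p ≈ q → a ∷ p ≈ b ∷ q
  ∷-cong e e′ .at zero    = e
  ∷-cong e e′ .at (suc i) = e′ .at i

  tail-≈ : ∀ {a b p q} → a ∷ p ≈ b ∷ q → p ≈ q
  tail-≈ e .at i = e .at (suc i)

  tail-≈0 : ∀ {a p} → a ∷ p ≈ 0# → p ≈ 0#
  tail-≈0 e .at i = e .at (suc i)

  0∷0≈0 : R.0# ∷ [] ≈ 0#
  0∷0≈0 .at zero    = R.refl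
  0∷0≈0 .at (suc i) = R.refl

  coeff-+ : ∀ p q i → coeff (p + q) i R.≈ coeff p i R.+ coeff q i
  coeff-+ []      q       i       = R.sym (R.+-identityˡ _)
  coeff-+ (a ∷ p) []      i       = R.sym (R.+-identityʳ _)
  coeff-+ (a ∷ p) (b ∷ q) zero    = R.refl
  coeff-+ (a ∷ p) (b ∷ q) (suc i) = coeff-+ p q i

  coeff-neg : ∀ p i → coeff (- p) i R.≈ R.- coeff p i
  coeff-neg []      i       = R.sym RP.-0#≈0#
  coeff-neg (a ∷ p) zero    = R.refl
  coeff-neg (a ∷ p) (suc i) = coeff-neg p i

  coeff-· : ∀ a p i → coeff (a · p) i R.≈ a R.* coeff p i
  coeff-· a []      i       = R.sym (R.zeroʳ a)
  coeff-· a (b ∷ p) zero    = R.refl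
  coeff-· a (b ∷ p) (suc i) = coeff-· a p i

  +-cong : ∀ {p p′ q q′} → p ≈ p′ → q ≈ q′ → p + q ≈ p′ + q′
  +-cong {p} {p′} {q} {q′} e e′ .at i = begin
    coeff (p + q) i             ≈⟨ coeff-+ p q i ⟩
    coeff p i R.+ coeff q i     ≈⟨ R.+-cong (e .at i) (e′ .at i) ⟩
    coeff p′ i R.+ coeff q′ i   ≈⟨ coeff-+ p′ q′ i ⟨
    coeff (p′ + q′) i           ∎
    where open R-Reasoning

  +-assoc : ∀ p q r → (p + q) + r ≈ p + (q + r)
  +-assoc p q r .at i = begin
    coeff ((p + q) + r) i                     ≈⟨ coeff-+ (p + q) r i ⟩
    coeff (p + q) i R.+ coeff r i             ≈⟨ R.+-congʳ (coeff-+ p q i) ⟩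
    coeff p i R.+ coeff q i R.+ coeff r i     ≈⟨ R.+-assoc _ _ _ ⟩
    coeff p i R.+ (coeff q i R.+ coeff r i)   ≈⟨ R.+-congˡ (coeff-+ q r i) ⟨
    coeff p i R.+ coeff (q + r) i             ≈⟨ coeff-+ p (q + r) i ⟨
    coeff (p + (q + r)) i                     ∎
    where open R-Reasoning

  +-comm : ∀ p q → p + q ≈ q + p
  +-comm p q .at i = begin
    coeff (p + q) i           ≈⟨ coeff-+ p q i ⟩
    coeff p i R.+ coeff q i   ≈⟨ R.+-comm _ _ ⟩
    coeff q i R.+ coeff p i   ≈⟨ coeff-+ q p i ⟨
    coeff (q + p) i           ∎
    where open R-Reasoning

  +-identityʳ : ∀ p → p + 0# ≈ p
  +-identityʳ []      = ≈-refl
  +-identityʳ (a ∷ p) = ≈-refl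

  neg-cong : ∀ {p q} → p ≈ q → - p ≈ - q
  neg-cong {p} {q} e .at i =
    R.trans (coeff-neg p i) (R.trans (R.-‿cong (e .at i)) (R.sym (coeff-neg q i)))

  +-inverseʳ : ∀ p → p + - p ≈ 0#
  +-inverseʳ p .at i = begin
    coeff (p + - p) i             ≈⟨ coeff-+ p (- p) i ⟩
    coeff p i R.+ coeff (- p) i   ≈⟨ R.+-congˡ (coeff-neg p i) ⟩
    coeff p i R.+ R.- coeff p i   ≈⟨ R.-‿inverseʳ _ ⟩
    R.0#                          ∎
    where open R-Reasoning

  +-interchange : ∀ p q r s → (p + q) + (r + s) ≈ (p + r) + (q + s)
  +-interchange p q r s .at i = begin
    coeff ((p + q) + (r + s)) i                                  ≈⟨ expand p q r s ⟩
    (coeff p i R.+ coeff q i) R.+ (coeff r i R.+ coeff s i)      ≈⟨ +-CSG.interchange _ _ _ _ ⟩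
    (coeff p i R.+ coeff r i) R.+ (coeff q i R.+ coeff s i)      ≈⟨ expand p r q s ⟨
    coeff ((p + r) + (q + s)) i                                  ∎
    where
    open R-Reasoning
    expand : ∀ p q r s → coeff ((p + q) + (r + s)) i R.≈
                         (coeff p i R.+ coeff q i) R.+ (coeff r i R.+ coeff s i)
    expand p q r s =
      R.trans (coeff-+ (p + q) (r + s) i) (R.+-cong (coeff-+ p q i) (coeff-+ r s i))

  ·-cong : ∀ {a b p q} → a R.≈ b → p ≈ q → a · p ≈ b · q
  ·-cong {a} {b} {p} {q} e e′ .at i =
    R.trans (coeff-· a p i) (R.trans (R.*-cong e (e′ .at i)) (R.sym (coeff-· b q i)))

  ·-zeroˡ : ∀ p → R.0# · p ≈ 0#
  ·-zeroˡ p .at i = R.trans (coeff-· R.0# p i) (R.zeroˡ _)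

  ·-identityˡ : ∀ p → R.1# · p ≈ p
  ·-identityˡ p .at i = R.trans (coeff-· R.1# p i) (R.*-identityˡ _)

  ·-assoc : ∀ a b p → (a R.* b) · p ≈ a · (b · p)
  ·-assoc a b p .at i = begin
    coeff ((a R.* b) · p) i     ≈⟨ coeff-· (a R.* b) p i ⟩
    a R.* b R.* coeff p i       ≈⟨ R.*-assoc _ _ _ ⟩
    a R.* (b R.* coeff p i)     ≈⟨ R.*-congˡ (coeff-· b p i) ⟨
    a R.* coeff (b · p) i       ≈⟨ coeff-· a (b · p) i ⟨
    coeff (a · (b · p)) i       ∎
    where open R-Reasoning

  ·-distribˡ : ∀ a p q → a · (p + q) ≈ a · p + a · q
  ·-distribˡ a p q .at i = begin
    coeff (a · (p + q)) i                     ≈⟨ coeff-· a (p + q) i ⟩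
    a R.* coeff (p + q) i                     ≈⟨ R.*-congˡ (coeff-+ p q i) ⟩
    a R.* (coeff p i R.+ coeff q i)           ≈⟨ R.distribˡ _ _ _ ⟩
    a R.* coeff p i R.+ a R.* coeff q i       ≈⟨ R.+-cong (coeff-· a p i) (coeff-· a q i) ⟨
    coeff (a · p) i R.+ coeff (a · q) i       ≈⟨ coeff-+ (a · p) (a · q) i ⟨
    coeff (a · p + a · q) i                   ∎
    where open R-Reasoning

  ·-distribʳ : ∀ a b p → (a R.+ b) · p ≈ a · p + b · p
  ·-distribʳ a b p .at i = begin
    coeff ((a R.+ b) · p) i                   ≈⟨ coeff-· (a R.+ b) p i ⟩
    (a R.+ b) R.* coeff p i                   ≈⟨ R.distribʳ _ _ _ ⟩
    a R.* coeff p i R.+ b R.* coeff p i       ≈⟨ R.+-cong (coeff-· a p i) (coeff-· b p i) ⟨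
    coeff (a · p) i R.+ coeff (b · p) i       ≈⟨ coeff-+ (a · p) (b · p) i ⟨
    coeff (a · p + b · p) i                   ∎
    where open R-Reasoning

  0∷-+ : ∀ p q → R.0# ∷ (p + q) ≈ (R.0# ∷ p) + (R.0# ∷ q)
  0∷-+ p q = ∷-cong (R.sym (R.+-identityˡ _)) ≈-refl

  *-congˡ : ∀ p {q q′} → q ≈ q′ → p * q ≈ p * q′
  *-congˡ []      e = ≈-refl
  *-congˡ (a ∷ p) e = +-cong (·-cong R.refl e) (∷-cong R.refl (*-congˡ p e))

  *-zeroˡ : ∀ {p} q → p ≈ 0# → p * q ≈ 0#
  *-zeroˡ {[]}    q e = ≈-refl
  *-zeroˡ {a ∷ p} q e = begin
    a · q + (R.0# ∷ p * q)     ≈⟨ +-cong (·-cong (e .at 0) ≈-refl)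
                                         (∷-cong R.refl (*-zeroˡ q (tail-≈0 e))) ⟩
    R.0# · q + (R.0# ∷ [])     ≈⟨ +-cong (·-zeroˡ q) 0∷0≈0 ⟩
    0#                         ∎
    where open P-Reasoning

  *-congʳ : ∀ {p p′} q → p ≈ p′ → p * q ≈ p′ * q
  *-congʳ {[]}    {p′}     q e = ≈-sym (*-zeroˡ q (≈-sym e))
  *-congʳ {a ∷ p} {[]}     q e = *-zeroˡ q e
  *-congʳ {a ∷ p} {b ∷ p′} q e =
    +-cong (·-cong (e .at 0) ≈-refl) (∷-cong R.refl (*-congʳ q (tail-≈ e)))

  *-cong : ∀ {p p′ q q′} → p ≈ p′ → q ≈ q′ → p * q ≈ p′ * q′
  *-cong {p} {p′} {q} {q′} e e′ = ≈-trans (*-congˡ p e′) (*-congʳ q′ e)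

  *-distribʳ : ∀ r p q → (p + q) * r ≈ p * r + q * r
  *-distribʳ r []      q       = ≈-refl
  *-distribʳ r (a ∷ p) []      = ≈-sym (+-identityʳ _)
  *-distribʳ r (a ∷ p) (b ∷ q) = begin
    (a R.+ b) · r + (R.0# ∷ (p + q) * r)                           ≈⟨ +-cong (·-distribʳ a b r) (∷-cong R.refl (*-distribʳ r p q)) ⟩
    (a · r + b · r) + (R.0# ∷ p * r + q * r)                       ≈⟨ +-cong ≈-refl (0∷-+ (p * r) (q * r)) ⟩
    (a · r + b · r) + ((R.0# ∷ p * r) + (R.0# ∷ q * r))            ≈⟨ +-interchange (a · r) (b · r) _ _ ⟩
    (a · r + (R.0# ∷ p * r)) + (b · r + (R.0# ∷ q * r))            ∎
    where open P-Reasoning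

  *-zeroʳ : ∀ p → p * 0# ≈ 0#
  *-zeroʳ []      = ≈-refl
  *-zeroʳ (a ∷ p) = ≈-trans (∷-cong R.refl (*-zeroʳ p)) 0∷0≈0

  *-∷ : ∀ p b q → p * (b ∷ q) ≈ b · p + (R.0# ∷ p * q)
  *-∷ []      b q = ≈-sym 0∷0≈0
  *-∷ (a ∷ p) b q = ∷-cong (R.+-congʳ (R.*-comm a b)) (begin
    a · q + p * (b ∷ q)                  ≈⟨ +-cong (≈-refl {a · q}) (*-∷ p b q) ⟩
    a · q + (b · p + (R.0# ∷ p * q))     ≈⟨ +-assoc (a · q) (b · p) _ ⟨
    (a · q + b · p) + (R.0# ∷ p * q)     ≈⟨ +-cong (+-comm (a · q) (b · p)) ≈-refl ⟩
    (b · p + a · q) + (R.0# ∷ p * q)     ≈⟨ +-assoc (b · p) (a · q) _ ⟩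
    b · p + (a · q + (R.0# ∷ p * q))     ∎)
    where open P-Reasoning

  *-comm : ∀ p q → p * q ≈ q * p
  *-comm []      q = ≈-sym (*-zeroʳ q)
  *-comm (a ∷ p) q = begin
    a · q + (R.0# ∷ p * q)     ≈⟨ +-cong (≈-refl {a · q}) (∷-cong R.refl (*-comm p q)) ⟩
    a · q + (R.0# ∷ q * p)     ≈⟨ *-∷ q a p ⟨
    q * (a ∷ p)                ∎
    where open P-Reasoning

  *-distribˡ : ∀ p q r → p * (q + r) ≈ p * q + p * r
  *-distribˡ p q r = begin
    p * (q + r)       ≈⟨ *-comm p (q + r) ⟩
    (q + r) * p       ≈⟨ *-distribʳ p q r ⟩
    q * p + r * p     ≈⟨ +-cong (*-comm q p) (*-comm r p) ⟩
    p * q + p * r     ∎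
    where open P-Reasoning

  ·-*-assoc : ∀ a p q → (a · p) * q ≈ a · (p * q)
  ·-*-assoc a []      q = ≈-refl
  ·-*-assoc a (b ∷ p) q = begin
    (a R.* b) · q + (R.0# ∷ (a · p) * q)         ≈⟨ +-cong (·-assoc a b q) (∷-cong (R.sym (R.zeroʳ a)) (·-*-assoc a p q)) ⟩
    a · (b · q) + a · (R.0# ∷ p * q)             ≈⟨ ·-distribˡ a (b · q) (R.0# ∷ p * q) ⟨
    a · (b · q + (R.0# ∷ p * q))                 ∎
    where open P-Reasoning

  0∷-* : ∀ p q → (R.0# ∷ p) * q ≈ R.0# ∷ p * q
  0∷-* p q = +-cong {q = R.0# ∷ p * q} (·-zeroˡ q) ≈-refl

  *-assoc : ∀ p q r → (p * q) * r ≈ p * (q * r)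
  *-assoc []      q r = ≈-refl
  *-assoc (a ∷ p) q r = begin
    (a · q + (R.0# ∷ p * q)) * r                 ≈⟨ *-distribʳ r (a · q) (R.0# ∷ p * q) ⟩
    (a · q) * r + (R.0# ∷ p * q) * r             ≈⟨ +-cong (·-*-assoc a q r) (0∷-* (p * q) r) ⟩
    a · (q * r) + (R.0# ∷ (p * q) * r)           ≈⟨ +-cong (≈-refl {a · (q * r)}) (∷-cong R.refl (*-assoc p q r)) ⟩
    a · (q * r) + (R.0# ∷ p * (q * r))           ∎
    where open P-Reasoning

  *-identityˡ : ∀ p → 1# * p ≈ p
  *-identityˡ p = begin
    R.1# · p + (R.0# ∷ [])     ≈⟨ +-cong (·-identityˡ p) 0∷0≈0 ⟩
    p + 0#                     ≈⟨ +-identityʳ p ⟩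
    p                          ∎
    where open P-Reasoning

  commutativeRing : CommutativeRing c ℓ
  commutativeRing = record
    { Carrier = Carrier
    ; _≈_     = _≈_
    ; _+_     = _+_
    ; _*_     = _*_
    ; -_      = -_
    ; 0#      = 0#
    ; 1#      = 1#
    ; isCommutativeRing = record
      { isRing = record
        { +-isAbelianGroup = record
          { isGroup = record
            { isMonoid = record
              { isSemigroup = record
                { isMagma = record { isEquivalence = ≈-isEquivalence ; ∙-cong = +-cong }
                ; assoc   = +-assoc
                }
              ; identity = (λ p → ≈-refl) , +-identityʳ
              }
            ; inverse = (λ p → ≈-trans (+-comm (- p) p) (+-inverseʳ p)) , +-inverseʳ
            ; ⁻¹-cong = neg-cong
            }
          ; comm = +-comm
          }
        ; *-cong     = *-cong
        ; *-assoc    = *-assoc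
        ; *-identity = *-identityˡ , λ p → ≈-trans (*-comm p 1#) (*-identityˡ p)
        ; distrib    = *-distribˡ , *-distribʳ
        }
      ; *-comm = *-comm
      }
    }

module Factorisation {c ℓ} (R : CommutativeRing c ℓ) where

  open CommutativeRing R
  open RawSemiringDefinitions (Semiring.rawSemiring semiring) using (Irreducible; product)

  FactorsInto : ℕ → Carrier → Set (c ⊔ ℓ)
  FactorsInto m f =
    Σ[ g ∈ Vector Carrier m ] (∀ i → Irreducible (g i)) × f ≈ product g

  -- Existence alone would leave the bound on "the" factorisation to
  -- uniqueness of factorisation, so every factorisation is bounded here.
  ProductOfAtMost : ℕ → Carrier → Set (c ⊔ ℓ)
  ProductOfAtMost k f =
    (∃[ m ] (m ℕ.≤ k × FactorsInto m f)) × (∀ m → FactorsInto m f → m ℕ.≤ k)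

-- Degrees take values in ℤ ₋, where ⊥₋ is the degree -∞ of the zero polynomial.

infixl 6 _+₋_
infixl 7 _·₋_

_+₋_ : ℤ ₋ → ℤ ₋ → ℤ ₋
[ x ] +₋ [ y ] = [ x ℤ.+ y ]
[ x ] +₋ ⊥₋    = ⊥₋
⊥₋    +₋ y     = ⊥₋

-- The value of k · (-∞) is junk: only degrees of nonzero polynomials are scaled.
_·₋_ : ℤ → ℤ ₋ → ℤ ₋
k ·₋ [ x ] = [ k ℤ.* x ]
k ·₋ ⊥₋    = ⊥₋

ℤ₋-totalOrder : TotalOrder _ _ _
ℤ₋-totalOrder = record
  { isTotalOrder = AddInfimum.≤₋-isTotalOrder-≡ ℤ._≤_ ℤ.≤-isTotalOrder }

max-≢ : ∀ {m} → Fin m → (Fin m → ℤ ₋) → ℤ ₋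
max-≢ {m} j v =
  Extrema.max ℤ₋-totalOrder ⊥₋ (map v (filter (λ i → ¬? (i Fin.≟ j)) (allFin m)))

-- Excluded middle makes the apartness of a Heyting field coincide with _≉_,
-- so that K is a field in the classical sense.

module Multivariate {c ℓ₁ ℓ₂} (em : ExcludedMiddle (c ⊔ ℓ₁ ⊔ ℓ₂))
                    (K : HeytingField c ℓ₁ ℓ₂) where

  𝕂[x₁⋯x_] : ℕ → CommutativeRing c ℓ₁
  𝕂[x₁⋯x zero  ] =
    HeytingCommutativeRing.commutativeRing (HeytingField.heytingCommutativeRing K)
  𝕂[x₁⋯x suc r ] = Polynomial.commutativeRing 𝕂[x₁⋯x r ]

  Poly : ℕ → Set c
  Poly r = CommutativeRing.Carrier 𝕂[x₁⋯x r ]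

  constant : ∀ r → HeytingField.Carrier K → Poly r
  constant zero    k = k
  constant (suc r) k = Polynomial.C 𝕂[x₁⋯x r ] (constant r k)

  IsConstant : ∀ r → Poly r → Set (c ⊔ ℓ₁)
  IsConstant r p = ∃[ k ] p ≈ constant r k
    where open CommutativeRing 𝕂[x₁⋯x r ]

  -- The degree in the last variable, which is x_{r+1} (not x_r).
  degLast : ∀ r → Poly (suc r) → ℤ ₋
  degLast r = Polynomial.degree 𝕂[x₁⋯x r ] (λ p q → em⇒dec (p ≈ q))
    where
    open CommutativeRing 𝕂[x₁⋯x r ]
    em⇒dec : (P : Set ℓ₁) → Dec P
    em⇒dec P = map′ lower (lift {ℓ = c ⊔ ℓ₂}) em

{-# OPTIONS --safe #-}
-- Weight the polynomials in x_s over 𝕂[x₁,…,x_{s-1}] by deg_{s-1}, giving x_s the weight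
-- -deg_{s-1} aₙ. The hypothesis says that a_j x_s^j is the unique term of f of maximal
-- weight. For every polynomial let its excess be its degree in x_s minus the least index
-- of a term of maximal weight. By Gauss's lemma the excess is additive, and f has
-- excess n - j. A factor of f of excess 0 and positive degree would have a leading
-- coefficient of degree greater than deg_{s-1} aₙ, yet dividing aₙ; so every
-- non-unit factor of f has excess at least 1, and there are at most n - j of them.

module Submission where

open import Level using (_⊔_; lift; lower) renaming (suc to lsuc)
open import Algebra.Apartness using (HeytingField)
import Algebra.Apartness.Properties.HeytingCommutativeRing as HeytingCommutativeRingProperties
open import Algebra.Bundles using (CommutativeRing; Semiring)
open import Algebra.Definitions.RawMagma using (_,_)
import Algebra.Definitions.RawSemiring as RawSemiringDefinitions
import Algebra.Properties.Ring as RingProperties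
open import Axiom.ExcludedMiddle using (ExcludedMiddle)
open import Data.Empty using (⊥-elim)
open import Data.Fin.Base using (Fin; toℕ; fromℕ; fromℕ<) renaming (zero to fzero; suc to fsuc)
import Data.Fin.Properties as Fin
open import Data.Integer.Base as ℤ using (ℤ; +_; pred)
import Data.Integer.Properties as ℤ
open import Data.Integer.Tactic.RingSolver using (solve-∀)
open import Data.List.Base using ([]; _∷_; tabulate)
import Data.List.Extrema as Extrema
import Data.List.Relation.Unary.All as All
open import Data.List.Membership.Propositional.Properties
  using (∈-map⁺; ∈-filter⁺; ∈-allFin)
open import Data.Nat.Base as ℕ using (ℕ; zero; suc; _∸_; _≤_; _<_; z≤n; s≤s)
import Data.Nat.Properties as ℕ
open import Data.Product.Base using (∃-syntax; _×_; _,_; proj₁; proj₂)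
open import Data.Sum.Base using (_⊎_; inj₁; inj₂)
open import Data.Vec.Functional using (Vector) renaming ([] to []ᵛ; _∷_ to _∷ᵛ_)
open import Relation.Binary.Bundles using (TotalOrder)
open import Relation.Binary.Construct.Add.Infimum.Strict ℤ._<_
  using (_<₋_; [<]-injective; <₋-transʳ)
open import Relation.Binary.Definitions using (Decidable; tri<; tri≈; tri>)
open import Relation.Binary.PropositionalEquality as ≡ using (_≡_; _≢_)
open import Relation.Nullary.Construct.Add.Infimum using (_₋; ⊥₋; [_])
open import Relation.Nullary.Decidable using (yes; no; map′; ¬?; decidable-stable)
open import Relation.Nullary.Negation.Core using (¬_)
open import Defs

lower-em : ∀ {a} b → ExcludedMiddle (a ⊔ b) → ExcludedMiddle a
lower-em b em = map′ lower (lift {ℓ = b}) em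

-- Valuations on commutative rings, and index arithmetic for products.

module _ {c ℓ} (R : CommutativeRing c ℓ) where

  open CommutativeRing R

  NoZeroDivisors : Set (c ⊔ ℓ)
  NoZeroDivisors = ∀ {a b} → ¬ a ≈ 0# → ¬ b ≈ 0# → ¬ a * b ≈ 0#

  -- Sublevel sets replace a value function, so -∞ needs no element of its own: 0 lies in all of
  -- them. As values are integers, `a ∉[ pred k ]` says that the value is at least `k`, so `*-exact`
  -- is the lower bound complementing `*-closed`.
  record Valuation v : Set (c ⊔ ℓ ⊔ lsuc v) where
    infix 4 _∈[_] _∉[_]
    field
      -- a ∈[ k ] means that the value of a, additive and -∞ at 0, is at most k.
      _∈[_] : Carrier → ℤ → Set v

    _∉[_] : Carrier → ℤ → Set v
    a ∉[ k ] = ¬ a ∈[ k ]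

    field
      ∈-resp-≈ : ∀ {a b k} → a ≈ b → a ∈[ k ] → b ∈[ k ]
      ∈-mono   : ∀ {a k l} → k ℤ.≤ l → a ∈[ k ] → a ∈[ l ]
      0∈       : ∀ {k} → 0# ∈[ k ]
      +-closed : ∀ {a b k} → a ∈[ k ] → b ∈[ k ] → a + b ∈[ k ]
      neg-closed : ∀ {a k} → a ∈[ k ] → - a ∈[ k ]
      *-closed : ∀ {a b k l} → a ∈[ k ] → b ∈[ l ] → a * b ∈[ k ℤ.+ l ]
      *-exact  : ∀ {a b k l} → a ∉[ pred k ] → b ∉[ pred l ] → a * b ∉[ pred (k ℤ.+ l) ]
      value    : ∀ {a} → ¬ a ≈ 0# → ∃[ k ] a ∈[ k ] × a ∉[ pred k ]

-- If `i` exceeds `b`, then `j` must drop below `c` to keep the sum. This is the combinatorial core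
-- of Gauss's lemma: away from one pair of indices, some factor contributes an index below its
-- bottom.
i+j≡b+c∧i≢b⇒i<b⊎j<c : ∀ {b c} i j → i ℕ.+ j ≡ b ℕ.+ c → i ≢ b → i < b ⊎ j < c
i+j≡b+c∧i≢b⇒i<b⊎j<c {b} {c} i j e i≢b with ℕ.<-cmp i b
... | tri< i<b _ _ = inj₁ i<b
... | tri≈ _ i≡b _ = ⊥-elim (i≢b i≡b)
... | tri> _ _ b<i = inj₂ (ℕ.≰⇒> λ c≤j → ℕ.<-irrefl (≡.sym e) (ℕ.+-mono-<-≤ b<i c≤j))

i+j<b+c⇒i<b⊎j<c : ∀ {b c} i j → i ℕ.+ j < b ℕ.+ c → i < b ⊎ j < c
i+j<b+c⇒i<b⊎j<c {b} {c} i j h with i ℕ.<? b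
... | yes i<b = inj₁ i<b
... | no  i≮b = inj₂ (ℕ.≰⇒> λ c≤j → ℕ.<⇒≱ h (ℕ.+-mono-≤ (ℕ.≮⇒≥ i≮b) c≤j))

-- Coefficients of products, and the degree.

module Coefficients {c ℓ} (R : CommutativeRing c ℓ) where

  private
    module R = CommutativeRing R
    module RP = RingProperties R.ring
  open Polynomial R

  module _ {s} (S : R.Carrier → Set s)
           (S-resp : ∀ {a b} → a R.≈ b → S a → S b) (0∈S : S R.0#)
           (+-closed : ∀ {a b} → S a → S b → S (a R.+ b)) where

    -- `S` is kept abstract so that one induction covers both vanishing coefficients and the
    -- sublevel sets of a valuation.
    coeff-*-∈ : ∀ p q m → (∀ i j → i ℕ.+ j ≡ m → S (coeff p i R.* coeff q j)) →
                S (coeff (p * q) m)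
    coeff-*-∈ []      q m h = 0∈S
    coeff-*-∈ (a ∷ p) q zero h = S-resp
      (R.sym (R.trans (coeff-+ (a · q) _ 0) (R.+-congʳ (coeff-· a q 0))))
      (+-closed (h 0 0 ≡.refl) 0∈S)
    coeff-*-∈ (a ∷ p) q (suc m) h = S-resp
      (R.sym (R.trans (coeff-+ (a · q) _ (suc m)) (R.+-congʳ (coeff-· a q (suc m)))))
      (+-closed (h 0 (suc m) ≡.refl)
                (coeff-*-∈ p q m λ i j e → h (suc i) j (≡.cong suc e)))

    coeff-*-main : ∀ p q b c →
      (∀ i j → i ℕ.+ j ≡ b ℕ.+ c → i ≢ b → S (coeff p i R.* coeff q j)) →
      ∃[ r ] S r × coeff (p * q) (b ℕ.+ c) R.≈ coeff p b R.* coeff q c R.+ r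
    coeff-*-main [] q b c h =
      R.0# , 0∈S , R.sym (R.trans (R.+-identityʳ _) (R.zeroˡ _))
    coeff-*-main (a ∷ p) q zero c h =
      coeff (R.0# ∷ p * q) c , rest c (λ i j e → h (suc i) j e λ ()) ,
      R.trans (coeff-+ (a · q) _ c) (R.+-congʳ (coeff-· a q c))
      where
      rest : ∀ m → (∀ i j → suc (i ℕ.+ j) ≡ m → S (coeff p i R.* coeff q j)) →
             S (coeff (R.0# ∷ p * q) m)
      rest zero    h = 0∈S
      rest (suc m) h = coeff-*-∈ p q m λ i j e → h i j (≡.cong suc e)
    coeff-*-main (a ∷ p) q (suc b) c h
      with r , r∈S , e ← coeff-*-main p q b c
             (λ i j e i≢b → h (suc i) j (≡.cong suc e) λ e′ → i≢b (ℕ.suc-injective e′)) =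
      a R.* coeff q (suc (b ℕ.+ c)) R.+ r , +-closed (h 0 _ ≡.refl λ ()) r∈S , (begin
        coeff (a · q + (R.0# ∷ p * q)) (suc (b ℕ.+ c))
          ≈⟨ coeff-+ (a · q) _ (suc (b ℕ.+ c)) ⟩
        coeff (a · q) (suc (b ℕ.+ c)) R.+ coeff (p * q) (b ℕ.+ c)
          ≈⟨ R.+-cong (coeff-· a q _) e ⟩
        a R.* coeff q (suc (b ℕ.+ c)) R.+ (coeff p b R.* coeff q c R.+ r)
          ≈⟨ R.+-assoc _ _ _ ⟨
        a R.* coeff q (suc (b ℕ.+ c)) R.+ coeff p b R.* coeff q c R.+ r
          ≈⟨ R.+-congʳ (R.+-comm _ _) ⟩
        coeff p b R.* coeff q c R.+ a R.* coeff q (suc (b ℕ.+ c)) R.+ r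
          ≈⟨ R.+-assoc _ _ _ ⟩
        coeff p b R.* coeff q c R.+ (a R.* coeff q (suc (b ℕ.+ c)) R.+ r) ∎)
      where open import Relation.Binary.Reasoning.Setoid R.setoid

  private
    +≈0 : ∀ {a b} → a R.≈ R.0# → b R.≈ R.0# → a R.+ b R.≈ R.0#
    +≈0 a≈0 b≈0 = R.trans (R.+-cong a≈0 b≈0) (R.+-identityˡ _)

    ≈0-resp : ∀ {a b} → a R.≈ b → a R.≈ R.0# → b R.≈ R.0#
    ≈0-resp a≈b a≈0 = R.trans (R.sym a≈b) a≈0

    *≈0 : ∀ {a b} → a R.≈ R.0# ⊎ b R.≈ R.0# → a R.* b R.≈ R.0#
    *≈0 (inj₁ a≈0) = R.trans (R.*-congʳ a≈0) (R.zeroˡ _)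
    *≈0 (inj₂ b≈0) = R.trans (R.*-congˡ b≈0) (R.zeroʳ _)

  coeff-*-zero : ∀ p q m →
    (∀ i j → i ℕ.+ j ≡ m → coeff p i R.≈ R.0# ⊎ coeff q j R.≈ R.0#) →
    coeff (p * q) m R.≈ R.0#
  coeff-*-zero p q m h =
    coeff-*-∈ (R._≈ R.0#) ≈0-resp R.refl +≈0 p q m λ i j e → *≈0 (h i j e)

  coeff-*-single : ∀ p q b c →
    (∀ i j → i ℕ.+ j ≡ b ℕ.+ c → i ≢ b → coeff p i R.≈ R.0# ⊎ coeff q j R.≈ R.0#) →
    coeff (p * q) (b ℕ.+ c) R.≈ coeff p b R.* coeff q c
  coeff-*-single p q b c h
    with r , r≈0 , e ← coeff-*-main (R._≈ R.0#) ≈0-resp R.refl +≈0 p q b c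
                         (λ i j e i≢b → *≈0 (h i j e i≢b)) =
    R.trans e (R.trans (R.+-congˡ r≈0) (R.+-identityʳ _))

  coeff-*-0 : ∀ p q → coeff (p * q) 0 R.≈ coeff p 0 R.* coeff q 0
  coeff-*-0 p q = coeff-*-single p q 0 0 λ where
    zero j e i≢0 → ⊥-elim (i≢0 ≡.refl)

  -- A relation with a natural number in place of `degree`: it excludes the zero polynomial, hence
  -- -∞, and involves no decision of equality.
  record HasDegree (p : Carrier) (n : ℕ) : Set ℓ where
    field
      leading≉0 : ¬ coeff p n R.≈ R.0#
      above≈0   : ∀ i → n < i → coeff p i R.≈ R.0#

  open HasDegree public

  HasDegree⇒≉0 : ∀ {p n} → HasDegree p n → ¬ p ≈ 0#
  HasDegree⇒≉0 {n = n} d p≈0 = d .leading≉0 (p≈0 .at n)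

  coeff≉0⇒≤ : ∀ {p n i} → HasDegree p n → ¬ coeff p i R.≈ R.0# → i ≤ n
  coeff≉0⇒≤ d pᵢ≉0 = ℕ.≮⇒≥ λ n<i → pᵢ≉0 (d .above≈0 _ n<i)

  HasDegree-unique : ∀ {p m n} → HasDegree p m → HasDegree p n → m ≡ n
  HasDegree-unique d d′ =
    ℕ.≤-antisym (coeff≉0⇒≤ d′ (d .leading≉0)) (coeff≉0⇒≤ d (d′ .leading≉0))

  HasDegree-resp-≈ : ∀ {p q n} → p ≈ q → HasDegree p n → HasDegree q n
  HasDegree-resp-≈ {n = n} e d .leading≉0 z = d .leading≉0 (R.trans (e .at n) z)
  HasDegree-resp-≈ e d .above≈0 i n<i = R.trans (R.sym (e .at i)) (d .above≈0 i n<i)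

  HasDegree-0⇒≈C : ∀ {p} → HasDegree p 0 → p ≈ C (coeff p 0)
  HasDegree-0⇒≈C d .at zero    = R.refl
  HasDegree-0⇒≈C d .at (suc i) = d .above≈0 (suc i) (s≤s z≤n)

  coeff-*-leading : ∀ {p q m n} → HasDegree p m → HasDegree q n →
    coeff (p * q) (m ℕ.+ n) R.≈ coeff p m R.* coeff q n
  coeff-*-leading {p} {q} {m} {n} d d′ = coeff-*-single p q m n h
    where
    h : ∀ i j → i ℕ.+ j ≡ m ℕ.+ n → i ≢ m → coeff p i R.≈ R.0# ⊎ coeff q j R.≈ R.0#
    -- The index lemma is applied with the two pairs exchanged, so that it yields an index above one
    -- of the degrees.
    h i j e i≢m with i+j≡b+c∧i≢b⇒i<b⊎j<c m n (≡.sym e) (λ m≡i → i≢m (≡.sym m≡i))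
    ... | inj₁ m<i = inj₁ (d .above≈0 i m<i)
    ... | inj₂ n<j = inj₂ (d′ .above≈0 j n<j)

  HasDegree-* : NoZeroDivisors R → ∀ {p q m n} →
    HasDegree p m → HasDegree q n → HasDegree (p * q) (m ℕ.+ n)
  HasDegree-* nzd d d′ .leading≉0 z =
    nzd (d .leading≉0) (d′ .leading≉0) (R.trans (R.sym (coeff-*-leading d d′)) z)
  HasDegree-* nzd {p} {q} {m} {n} d d′ .above≈0 k m+n<k = coeff-*-zero p q k h
    where
    h : ∀ i j → i ℕ.+ j ≡ k → coeff p i R.≈ R.0# ⊎ coeff q j R.≈ R.0#
    h i j e with i+j<b+c⇒i<b⊎j<c m n (≡.subst (m ℕ.+ n <_) (≡.sym e) m+n<k)
    ... | inj₁ m<i = inj₁ (d .above≈0 i m<i)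
    ... | inj₂ n<j = inj₂ (d′ .above≈0 j n<j)

  module _ (_≟_ : Decidable R._≈_) where

    degree-spec : ∀ p → (degree _≟_ p ≡ ⊥₋ × p ≈ 0#) ⊎
                        (∃[ n ] degree _≟_ p ≡ [ + n ] × HasDegree p n)
    degree-spec [] = inj₁ (≡.refl , ≈-refl)
    degree-spec (a ∷ p) with degree _≟_ p | degree-spec p
    ... | _ | inj₂ (n , ≡.refl , d) = inj₂ (suc n , ≡.refl , record
      { leading≉0 = d .leading≉0
      ; above≈0   = λ { (suc i) (s≤s n<i) → d .above≈0 i n<i } })
    ... | _ | inj₁ (≡.refl , p≈0) with a ≟ R.0#
    ...   | yes a≈0 = inj₁ (≡.refl , ≈-trans (∷-cong a≈0 p≈0) 0∷0≈0)
    ...   | no  a≉0 = inj₂ (0 , ≡.refl , record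
      { leading≉0 = a≉0
      ; above≈0   = λ { (suc i) _ → p≈0 .at i } })

    hasDegree : ∀ {p} → ¬ p ≈ 0# → ∃[ n ] HasDegree p n
    hasDegree {p} p≉0 with degree-spec p
    ... | inj₁ (_ , p≈0)   = ⊥-elim (p≉0 p≈0)
    ... | inj₂ (n , _ , d) = n , d

    noZeroDivisors : NoZeroDivisors R → NoZeroDivisors commutativeRing
    noZeroDivisors nzd p≉0 q≉0 =
      HasDegree⇒≉0 (HasDegree-* nzd (proj₂ (hasDegree p≉0)) (proj₂ (hasDegree q≉0)))

    -- Level `k` asks the coefficients of index above `k` to vanish, so negative levels contain only
    -- 0. Exactness holds because the leading coefficients have a nonzero product.
    degreeValuation : NoZeroDivisors R → Valuation commutativeRing ℓ
    degreeValuation nzd = record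
      { _∈[_]      = _∈[_]
      ; ∈-resp-≈   = λ e h i k<i → R.trans (R.sym (e .at i)) (h i k<i)
      ; ∈-mono     = λ k≤l h i l<i → h i (ℤ.≤-<-trans k≤l l<i)
      ; 0∈         = λ _ _ → R.refl
      ; +-closed   = λ {p} {q} h h′ i k<i → R.trans (coeff-+ p q i) (+≈0 (h i k<i) (h′ i k<i))
      ; neg-closed = λ {p} h i k<i →
          R.trans (coeff-neg p i) (R.trans (R.-‿cong (h i k<i)) RP.-0#≈0#)
      ; *-closed   = λ {p} {q} → *-closed {p} {q}
      ; *-exact    = λ {p} {q} {k} {l} → *-exact {p} {q} {k} {l}
      ; value      = value
      }
      where
      infix 4 _∈[_]
      _∈[_] : Carrier → ℤ → Set ℓ
      p ∈[ k ] = ∀ i → k ℤ.< + i → coeff p i R.≈ R.0#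

      *-closed : ∀ {p q k l} → p ∈[ k ] → q ∈[ l ] → p * q ∈[ k ℤ.+ l ]
      *-closed {p} {q} {k} {l} h h′ m k+l<m = coeff-*-zero p q m g
        where
        g : ∀ i j → i ℕ.+ j ≡ m → coeff p i R.≈ R.0# ⊎ coeff q j R.≈ R.0#
        g i j ≡.refl with k ℤ.<? + i
        ... | yes k<i = inj₁ (h i k<i)
        ... | no  k≮i = inj₂ (h′ j (ℤ.≰⇒> λ j≤l →
                ℤ.<⇒≱ k+l<m (ℤ.+-mono-≤ (ℤ.≮⇒≥ k≮i) j≤l)))

      exact : ∀ {p k n} → HasDegree p n → ¬ p ∈[ pred k ] → k ℤ.≤ + n
      exact {k = k} {n} d p∉ = ℤ.≮⇒≥ λ n<k → p∉ λ i pk<i →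
        d .above≈0 i (ℤ.drop‿+<+ (ℤ.≤-<-trans (ℤ.i<j⇒i≤pred[j] n<k) pk<i))

      ∉⇒≉0 : ∀ {p k} → ¬ p ∈[ k ] → ¬ p ≈ 0#
      ∉⇒≉0 p∉ p≈0 = p∉ λ i _ → p≈0 .at i

      *-exact : ∀ {p q k l} → ¬ p ∈[ pred k ] → ¬ q ∈[ pred l ] →
                ¬ p * q ∈[ pred (k ℤ.+ l) ]
      *-exact {p} {q} {k} {l} p∉ q∉ h
        with m , d ← hasDegree {p} (∉⇒≉0 {k = pred k} p∉)
           | n , d′ ← hasDegree {q} (∉⇒≉0 {k = pred l} q∉) =
        HasDegree-* nzd d d′ .leading≉0 (h (m ℕ.+ n)
          (ℤ.i≤pred[j]⇒i<j (ℤ.pred-mono (ℤ.+-mono-≤ (exact {k = k} d p∉) (exact {k = l} d′ q∉)))))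

      value : ∀ {p} → ¬ p ≈ 0# → ∃[ k ] p ∈[ k ] × ¬ p ∈[ pred k ]
      value p≉0 with n , d ← hasDegree p≉0 =
        + n , (λ i n<i → d .above≈0 i (ℤ.drop‿+<+ n<i)) ,
        λ h → d .leading≉0 (h n (ℤ.i≤pred[j]⇒i<j ℤ.≤-refl))

-- Gauss values and the least index attaining them.

module Bottom {c ℓ v} (R : CommutativeRing c ℓ) (V : Valuation R v) (w : ℤ) where

  private
    module R = CommutativeRing R
    module RP = RingProperties R.ring
  open Polynomial R
  open Coefficients R
  open Valuation V

  private
    -- A coefficient of value `i at-level k` gives a term `pᵢ xⁱ` of value `k` when `x` has value
    -- `-w`.
    _at-level_ : ℕ → ℤ → ℤ
    i at-level k = k ℤ.+ w ℤ.* + i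

    level-+ : ∀ i j k l → i at-level k ℤ.+ j at-level l ≡ (i ℕ.+ j) at-level (k ℤ.+ l)
    level-+ i j k l = identity w k l (+ i) (+ j)
      where
      identity : ∀ w k l i j →
        (k ℤ.+ w ℤ.* i) ℤ.+ (l ℤ.+ w ℤ.* j) ≡ (k ℤ.+ l) ℤ.+ w ℤ.* (i ℤ.+ j)
      identity = solve-∀

    level-suc : ∀ i k → i at-level k ≡ suc i at-level (k ℤ.- w)
    level-suc i k = identity w k (+ i)
      where
      identity : ∀ w k i → k ℤ.+ w ℤ.* i ≡ (k ℤ.- w) ℤ.+ w ℤ.* (+ 1 ℤ.+ i)
      identity = solve-∀

    level-0 : ∀ k → 0 at-level k ≡ k
    level-0 k = ≡.trans (≡.cong (ℤ._+_ k) (ℤ.*-zeroʳ w)) (ℤ.+-identityʳ k)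

    level-mono : ∀ i {k l} → k ℤ.≤ l → i at-level k ℤ.≤ i at-level l
    level-mono i = ℤ.+-monoˡ-≤ (w ℤ.* + i)

    pred≤ : ∀ k → pred k ℤ.≤ k
    pred≤ k = ℤ.i≤j⇒pred[i]≤j ℤ.≤-refl

  -- When x has value -w, k is the Gauss value of p = Σ pᵢ xⁱ, and b is the least
  -- index of a term attaining it.
  record IsBottom (p : Carrier) (b : ℕ) (k : ℤ) : Set v where
    field
      bound  : ∀ i → coeff p i ∈[ i at-level k ]
      strict : ∀ i → i < b → coeff p i ∈[ pred (i at-level k) ]
      exact  : coeff p b ∉[ pred (b at-level k) ]

  open IsBottom public

  IsBottom-resp-≈ : ∀ {p q b k} → p ≈ q → IsBottom p b k → IsBottom q b k
  IsBottom-resp-≈ e β .bound i      = ∈-resp-≈ (e .at i) (β .bound i)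
  IsBottom-resp-≈ e β .strict i i<b = ∈-resp-≈ (e .at i) (β .strict i i<b)
  IsBottom-resp-≈ {b = b} e β .exact h = β .exact (∈-resp-≈ (R.sym (e .at b)) h)

  bottom≉0 : ∀ {p b k} → IsBottom p b k → ¬ coeff p b R.≈ R.0#
  bottom≉0 β z = β .exact (∈-resp-≈ (R.sym z) 0∈)

  -- The levels are compared first: a smaller level would bound the coefficient at the other bottom
  -- too well for `exact`. Once they agree, a smaller bottom index would violate `strict` of the
  -- other.
  IsBottom-unique : ∀ {p b b′ k k′} → IsBottom p b k → IsBottom p b′ k′ → b ≡ b′
  IsBottom-unique {p} β β′ =
    ℕ.≤-antisym (least β β′ level≡) (least β′ β (≡.sym level≡))
    where
    level≤ : ∀ {b b′ k k′} → IsBottom p b k → IsBottom p b′ k′ → k ℤ.≤ k′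
    level≤ {b} β β′ = ℤ.≮⇒≥ λ k′<k → β .exact
      (∈-mono (ℤ.i<j⇒i≤pred[j] (ℤ.+-monoˡ-< (w ℤ.* + b) k′<k)) (β′ .bound b))
    level≡ = ℤ.≤-antisym (level≤ β β′) (level≤ β′ β)
    least : ∀ {b b′ k k′} → IsBottom p b k → IsBottom p b′ k′ → k ≡ k′ → b ≤ b′
    least β β′ ≡.refl = ℕ.≮⇒≥ λ b′<b → β′ .exact (β .strict _ b′<b)

  -- Gauss's lemma, keeping track of the index as well as of the value. In the coefficient at
  -- `b + c`, every product except that of the two bottom coefficients has an index below one of the
  -- bottoms, so it is too small to cancel that product.
  IsBottom-* : ∀ {p q b c k l} →
    IsBottom p b k → IsBottom q c l → IsBottom (p * q) (b ℕ.+ c) (k ℤ.+ l)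
  IsBottom-* {p} {q} {b} {c} {k} {l} β γ = record
    { bound  = λ m → coeff-*-∈ _ ∈-resp-≈ 0∈ +-closed p q m λ { i j ≡.refl →
        ≡.subst (_ ∈[_]) (level-+ i j k l) (*-closed (β .bound i) (γ .bound j)) }
    ; strict = λ m m<b+c → coeff-*-∈ _ ∈-resp-≈ 0∈ +-closed p q m λ { i j ≡.refl →
        small i j (i+j<b+c⇒i<b⊎j<c i j m<b+c) }
    ; exact  = exact-*
    }
    where
    small : ∀ i j → i < b ⊎ j < c →
            coeff p i R.* coeff q j ∈[ pred ((i ℕ.+ j) at-level (k ℤ.+ l)) ]
    small i j (inj₁ i<b) = ≡.subst (_ ∈[_])
      (≡.trans (ℤ.pred-+ (i at-level k) _) (≡.cong pred (level-+ i j k l)))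
      (*-closed (β .strict i i<b) (γ .bound j))
    small i j (inj₂ j<c) = ≡.subst (_ ∈[_])
      (≡.trans (ℤ.+-pred (i at-level k) _) (≡.cong pred (level-+ i j k l)))
      (*-closed (β .bound i) (γ .strict j j<c))

    exact-* : coeff (p * q) (b ℕ.+ c) ∉[ pred ((b ℕ.+ c) at-level (k ℤ.+ l)) ]
    exact-* h
      with r , r∈ , e ← coeff-*-main _ ∈-resp-≈ 0∈ +-closed p q b c (λ i j i+j≡b+c i≢b →
        ≡.subst (λ m → coeff p i R.* coeff q j ∈[ pred (m at-level (k ℤ.+ l)) ]) i+j≡b+c
          (small i j (i+j≡b+c∧i≢b⇒i<b⊎j<c i j i+j≡b+c i≢b))) =
      -- Were the whole coefficient small, subtracting the small remainder `r` would make the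
      -- product of the bottom coefficients small.
      *-exact {k = b at-level k} {c at-level l} (β .exact) (γ .exact)
        (≡.subst (λ m → _ ∈[ pred m ]) (≡.sym (level-+ b c k l))
          (∈-resp-≈ (cancel e) (+-closed h (neg-closed r∈))))
      where
      cancel : ∀ {x y r} → x R.≈ y R.+ r → x R.+ R.- r R.≈ y
      cancel {x} {y} {r} e = R.trans (R.+-congʳ e) (R.trans (R.+-assoc y r (R.- r))
        (R.trans (R.+-congˡ (R.-‿inverseʳ r)) (R.+-identityʳ y)))

  module _ (_≟_ : Decidable R._≈_) where

    private
      ∷-bottom-suc : ∀ {a p b k} → IsBottom p b k → a ∈[ pred (k ℤ.- w) ] →
                     IsBottom (a ∷ p) (suc b) (k ℤ.- w)
      ∷-bottom-suc {a} {p} {b} {k} β a∈ = record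
        { bound  = λ where
            zero    → ∈-mono (pred≤ _) a∈′
            (suc i) → ≡.subst (_ ∈[_]) (level-suc i k) (β .bound i)
        ; strict = λ where
            zero    _         → a∈′
            (suc i) (s≤s i<b) →
              ≡.subst (λ m → _ ∈[ pred m ]) (level-suc i k) (β .strict i i<b)
        ; exact  = λ h →
            β .exact (≡.subst (λ m → _ ∈[ pred m ]) (≡.sym (level-suc b k)) h)
        }
        where
        a∈′ : a ∈[ pred (0 at-level (k ℤ.- w)) ]
        a∈′ = ≡.subst (λ m → a ∈[ pred m ]) (≡.sym (level-0 (k ℤ.- w))) a∈

      ∷-bottom-zero : ∀ {a p l} → a ∈[ l ] → a ∉[ pred l ] →
        (∀ i → coeff p i ∈[ suc i at-level l ]) → IsBottom (a ∷ p) 0 l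
      ∷-bottom-zero {l = l} a∈ a∉ h = record
        { bound  = λ where
            zero    → ≡.subst (_ ∈[_]) (≡.sym (level-0 l)) a∈
            (suc i) → h i
        ; strict = λ _ ()
        ; exact  = λ h → a∉ (≡.subst (λ m → _ ∈[ pred m ]) (level-0 l) h)
        }

    -- Prepending a coefficient multiplies the tail by `x`, which lowers its level by `w`. The new
    -- coefficient becomes the bottom unless its value is below `k - w`; a tie goes to index 0, the
    -- least.
    bottom : ∀ p → p ≈ 0# ⊎ (∃[ b ] ∃[ k ] IsBottom p b k)
    bottom [] = inj₁ ≈-refl
    bottom (a ∷ p) with bottom p | a ≟ R.0#
    ... | inj₁ p≈0 | yes a≈0 = inj₁ (≈-trans (∷-cong a≈0 p≈0) 0∷0≈0)
    ... | inj₁ p≈0 | no  a≉0 with l , a∈ , a∉ ← value a≉0 =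
      inj₂ (0 , l , ∷-bottom-zero a∈ a∉ λ i → ∈-resp-≈ (R.sym (p≈0 .at i)) 0∈)
    ... | inj₂ (b , k , β) | yes a≈0 =
      inj₂ (suc b , k ℤ.- w , ∷-bottom-suc β (∈-resp-≈ (R.sym a≈0) 0∈))
    ... | inj₂ (b , k , β) | no a≉0 with l , a∈ , a∉ ← value a≉0 with l ℤ.<? k ℤ.- w
    ...   | yes l<k-w =
      inj₂ (suc b , k ℤ.- w , ∷-bottom-suc β (∈-mono (ℤ.i<j⇒i≤pred[j] l<k-w) a∈))
    ...   | no  l≮k-w = inj₂ (0 , l , ∷-bottom-zero a∈ a∉ λ i →
      ∈-mono (ℤ.≤-trans (ℤ.≤-reflexive (level-suc i k))
                        (level-mono (suc i) (ℤ.≮⇒≥ l≮k-w))) (β .bound i))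

-- The excess of a polynomial.

module Excess {c ℓ v} (R : CommutativeRing c ℓ) (_≟_ : Decidable (CommutativeRing._≈_ R))
              (nzd : NoZeroDivisors R) (V : Valuation R v) (w : ℤ) where

  private
    module R = CommutativeRing R
  open Polynomial R
  open Coefficients R
  open Bottom R V w
  open Valuation V
  open RawSemiringDefinitions (Semiring.rawSemiring (CommutativeRing.semiring commutativeRing))
    using (_∣_)

  -- The difference of degree and bottom index is stated as a sum, so that additivity involves no
  -- truncated subtraction.
  HasExcess : Carrier → ℕ → Set (ℓ ⊔ v)
  HasExcess p e = ∃[ n ] ∃[ b ] ∃[ k ] HasDegree p n × IsBottom p b k × n ≡ e ℕ.+ b

  hasExcess : ∀ {p} → ¬ p ≈ 0# → ∃[ e ] HasExcess p e
  hasExcess {p} p≉0 with bottom _≟_ p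
  ... | inj₁ p≈0 = ⊥-elim (p≉0 p≈0)
  ... | inj₂ (b , k , β) with n , d ← hasDegree _≟_ p≉0 =
    n ∸ b , n , b , k , d , β , ≡.sym (ℕ.m∸n+n≡m (coeff≉0⇒≤ d (bottom≉0 β)))

  HasExcess-resp-≈ : ∀ {p q e} → p ≈ q → HasExcess p e → HasExcess q e
  HasExcess-resp-≈ p≈q (n , b , k , d , β , eq) =
    n , b , k , HasDegree-resp-≈ p≈q d , IsBottom-resp-≈ p≈q β , eq

  HasExcess-unique : ∀ {p e e′} → HasExcess p e → HasExcess p e′ → e ≡ e′
  HasExcess-unique {e = e} {e′} (_ , b , _ , d , β , eq) (_ , b′ , _ , d′ , β′ , eq′) =
    ℕ.+-cancelʳ-≡ b e e′ (begin
      e ℕ.+ b    ≡⟨ eq ⟨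
      _          ≡⟨ HasDegree-unique d d′ ⟩
      _          ≡⟨ eq′ ⟩
      e′ ℕ.+ b′  ≡⟨ ≡.cong (e′ ℕ.+_) (IsBottom-unique β′ β) ⟩
      e′ ℕ.+ b   ∎)
    where open ≡.≡-Reasoning

  HasExcess-* : ∀ {p q e e′} → HasExcess p e → HasExcess q e′ → HasExcess (p * q) (e ℕ.+ e′)
  HasExcess-* {e = e} {e′} (_ , b , _ , d , β , ≡.refl) (_ , b′ , _ , d′ , β′ , ≡.refl) =
    _ , _ , _ , HasDegree-* nzd d d′ , IsBottom-* β β′ , interchange e b e′ b′
    where
    open import Algebra.Properties.CommutativeSemigroup ℕ.+-commutativeSemigroup
      using (interchange)

  -- A factor g of excess 0 and positive degree N has its only term of maximal weight
  -- at N. As its constant term is nonzero, its leading coefficient has value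
  -- greater than N w ≥ w, so it cannot divide the leading coefficient of f.
  excess-0⇒∣1 : ∀ {f n} → HasDegree f n → ¬ coeff f 0 R.≈ R.0# →
    coeff f n ∈[ w ] → ℤ.0ℤ ℤ.≤ w →
    (∀ {a} → ¬ a R.≈ R.0# → a ∉[ pred ℤ.0ℤ ]) →
    (∀ {u} → ¬ u R.≈ R.0# → C u ∣ f → C u ∣ 1#) →
    ∀ {g} → g ∣ f → HasExcess g 0 → g ∣ 1#
  excess-0⇒∣1 {f} {n} df f₀≉0 fₙ∈ 0≤w nonneg units {g} g∣f (zero , _ , _ , dg , _ , ≡.refl) =
    ∣-respˡ (≈-sym g≈C) (units (dg .leading≉0) (∣-respˡ g≈C g∣f))
    where
    open import Algebra.Properties.Semiring.Divisibility
      (CommutativeRing.semiring commutativeRing) using (∣-respˡ)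
    g≈C : g ≈ C (coeff g 0)
    g≈C = HasDegree-0⇒≈C dg
  excess-0⇒∣1 {f} {n} df f₀≉0 fₙ∈ 0≤w nonneg units {g}
    (q , qg≈f) (suc N , _ , k , dg , β , ≡.refl)
    with M , dq ← hasDegree _≟_ {q} (λ q≈0 → HasDegree⇒≉0 df
                    (≈-trans (≈-sym qg≈f) (*-zeroˡ g q≈0)))
    with ≡.refl ← HasDegree-unique df (HasDegree-resp-≈ qg≈f (HasDegree-* nzd dq dg)) =
    ⊥-elim (*-exact {k = ℤ.0ℤ} {k ℤ.+ w ℤ.* + suc N} (nonneg (dq .leading≉0)) (β .exact)
      (∈-mono w≤ (∈-resp-≈
        (R.trans (R.sym (qg≈f .at _)) (coeff-*-leading dq dg)) fₙ∈)))
    where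
    g₀≉0 : ¬ coeff g 0 R.≈ R.0#
    g₀≉0 g₀≈0 = f₀≉0 (R.trans (R.sym (qg≈f .at 0))
      (R.trans (coeff-*-0 q g) (R.trans (R.*-congˡ g₀≈0) (R.zeroʳ _))))

    0<k : ℤ.0ℤ ℤ.< k
    0<k = ℤ.≰⇒> λ k≤0 → nonneg g₀≉0 (∈-mono
      (ℤ.pred-mono (ℤ.≤-trans (ℤ.≤-reflexive (k+w*0≡k k w)) k≤0)) (β .strict 0 (s≤s z≤n)))
      where
      k+w*0≡k : ∀ k w → k ℤ.+ w ℤ.* + 0 ≡ k
      k+w*0≡k = solve-∀

    w≤ : w ℤ.≤ pred (ℤ.0ℤ ℤ.+ (k ℤ.+ w ℤ.* + suc N))
    w≤ = ℤ.i<j⇒i≤pred[j] (begin-strict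
      w                                ≡⟨ ℤ.*-identityʳ w ⟨
      w ℤ.* + 1                        ≤⟨ ℤ.*-monoˡ-≤-nonNeg w {{ℤ.nonNegative 0≤w}}
                                            (ℤ.+≤+ (s≤s z≤n)) ⟩
      w ℤ.* + suc N                    ≡⟨ ℤ.+-identityˡ _ ⟨
      ℤ.0ℤ ℤ.+ w ℤ.* + suc N           <⟨ ℤ.+-monoˡ-< (w ℤ.* + suc N) 0<k ⟩
      k ℤ.+ w ℤ.* + suc N              ≡⟨ ℤ.+-identityˡ _ ⟨
      ℤ.0ℤ ℤ.+ (k ℤ.+ w ℤ.* + suc N)   ∎)
      where open ℤ.≤-Reasoning

-- Counting irreducible factors by an additive measure.

module FactorCount {c ℓ} (F : CommutativeRing c ℓ) (em : ExcludedMiddle (c ⊔ ℓ)) where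

  open CommutativeRing F
  open RawSemiringDefinitions (Semiring.rawSemiring semiring)
    using (Irreducible; mkIrred; product; _∣_; _∤_)
  open Factorisation F
  open import Algebra.Properties.Semiring.Divisibility semiring
    using (∣-refl; ∣-trans; ∣-respˡ; ∣-respʳ; x∣y∧y≉0⇒x≉0; x∣ʳyx)
  open import Algebra.Properties.CommutativeSemigroup.Divisibility *-commutativeSemigroup
    using (x∣xy)

  -- The measure acts as a length function on the divisors of `f`: each nonunit divisor has measure
  -- at least 1, which bounds the number of factors and makes repeated splitting terminate. It is
  -- instantiated with the excess.
  module AdditiveMeasure {e} (HasMeasure : Carrier → ℕ → Set e)
    (measure  : ∀ {g} → g ≉ 0# → ∃[ m ] HasMeasure g m)
    (respects : ∀ {g h m} → g ≈ h → HasMeasure g m → HasMeasure h m)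
    (unique   : ∀ {g m n} → HasMeasure g m → HasMeasure g n → m ≡ n)
    (additive : ∀ {g h m n} → HasMeasure g m → HasMeasure h n → HasMeasure (g * h) (m ℕ.+ n))
    {f : Carrier} (f≉0 : f ≉ 0#)
    (measure-0⇒∣1 : ∀ {g} → g ∣ f → HasMeasure g 0 → g ∣ 1#)
    where

    private
      divisor-measure : ∀ {g} → g ∣ f → ∃[ m ] HasMeasure g m
      divisor-measure g∣f = measure (x∣y∧y≉0⇒x≉0 g∣f f≉0)

      nonunit-measure : ∀ {g m} → g ∣ f → g ∤ 1# → HasMeasure g m → 1 ≤ m
      nonunit-measure {m = zero}  g∣f g∤1 μ = ⊥-elim (g∤1 (measure-0⇒∣1 g∣f μ))
      nonunit-measure {m = suc m} g∣f g∤1 μ = s≤s z≤n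

      1≉0 : 1# ≉ 0#
      1≉0 1≈0 = f≉0 (trans (sym (*-identityˡ f)) (trans (*-congʳ 1≈0) (zeroˡ f)))

      -- Additivity on `1# * 1# ≈ 1#` gives `m + m ≡ m`.
      measure-1 : ∀ {m} → HasMeasure 1# m → m ≡ 0
      measure-1 {m} μ =
        ℕ.+-cancelˡ-≡ m m 0 (≡.trans (unique (respects (*-identityˡ 1#) (additive μ μ)) μ)
                                     (≡.sym (ℕ.+-identityʳ m)))

    measure-unit : ∀ {g m} → g ∣ 1# → HasMeasure g m → m ≡ 0
    measure-unit {g} {m} (q , qg≈1) μ
      with k , κ ← measure (x∣y∧y≉0⇒x≉0 (x∣xy q g) (λ qg≈0 → 1≉0 (trans (sym qg≈1) qg≈0))) =
      ℕ.m+n≡0⇒n≡0 k (measure-1 (respects qg≈1 (additive κ μ)))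

    -- The measures of two factors of `f` add up to 1, so one of them is 0 and belongs to a unit.
    measure-1⇒irreducible : HasMeasure f 1 → Irreducible f
    measure-1⇒irreducible μ = mkIrred
      (λ f∣1 → ℕ.1+n≢0 (measure-unit f∣1 μ)) split
      where
      split : ∀ {x y} → f ≈ x * y → x ∣ 1# ⊎ y ∣ 1#
      split {x} {y} f≈xy
        with x∣f ← ∣-respʳ (sym f≈xy) (x∣xy x y) | y∣f ← ∣-respʳ (sym f≈xy) (x∣ʳyx y x)
        with i , ξ ← divisor-measure x∣f | j , η ← divisor-measure y∣f
        with i+j≡1 ← unique (additive ξ η) (respects f≈xy μ)
        with i | j
      ... | zero  | _    = inj₁ (measure-0⇒∣1 x∣f ξ)
      ... | suc _ | zero = inj₂ (measure-0⇒∣1 y∣f η)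
      ... | suc i | suc j with () ← ≡.trans (≡.sym (ℕ.+-suc i j)) (ℕ.suc-injective i+j≡1)

    -- Each irreducible factor is a nonunit divisor of `f` and so uses up at least 1 of the total
    -- `k`.
    factor-count-≤ : ∀ {k} → HasMeasure f k → ∀ m → FactorsInto m f → m ≤ k
    factor-count-≤ {k} μ m (g , irr , f≈∏) =
      count m g irr (∣-respʳ (sym f≈∏) ∣-refl) (respects f≈∏ μ)
      where
      -- Divisibility of `f` is carried along, since `measure-0⇒∣1` speaks only of divisors of `f`.
      count : ∀ m (g : Vector Carrier m) → (∀ i → Irreducible (g i)) →
              product g ∣ f → ∀ {k} → HasMeasure (product g) k → m ≤ k
      count zero    g irr ∏∣f μ = z≤n
      count (suc m) g irr ∏∣f μ
        with g₀∣f ← ∣-trans (x∣xy (g fzero) _) ∏∣f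
           | ∏′∣f ← ∣-trans (x∣ʳyx (product λ i → g (fsuc i)) (g fzero)) ∏∣f
        with i , γ ← divisor-measure g₀∣f | j , π ← divisor-measure ∏′∣f
        with ≡.refl ← unique μ (additive γ π) =
        ℕ.+-mono-≤ (nonunit-measure g₀∣f (Irreducible.p∤1 (irr fzero)) γ)
                   (count m _ (λ i → irr (fsuc i)) ∏′∣f π)

    private
      irreducible⊎reducible : ∀ {g} → g ∤ 1# →
        Irreducible g ⊎ (∃[ x ] ∃[ y ] g ≈ x * y × x ∤ 1# × y ∤ 1#)
      irreducible⊎reducible {g} g∤1
        with em {∃[ x ] ∃[ y ] g ≈ x * y × x ∤ 1# × y ∤ 1#}
      ... | yes red = inj₂ red
      ... | no ¬red = inj₁ (mkIrred g∤1 split)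
        where
        split : ∀ {x y} → g ≈ x * y → x ∣ 1# ⊎ y ∣ 1#
        split {x} {y} g≈xy with em {x ∣ 1#} | em {y ∣ 1#}
        ... | yes x∣1 | _       = inj₁ x∣1
        ... | no  _   | yes y∣1 = inj₂ y∣1
        ... | no  x∤1 | no  y∤1 = ⊥-elim (¬red (x , y , g≈xy , x∤1 , y∤1))

      -- The cofactor h accumulates factorisations, so that none have to be concatenated.
      factorise : ∀ N {g k} → k ≤ N → g ∣ f → g ∤ 1# → HasMeasure g k →
        ∀ {m h} → FactorsInto m h → ∃[ m′ ] m′ ≤ k ℕ.+ m × FactorsInto m′ (g * h)
      factorise zero z≤n g∣f g∤1 γ _ = ⊥-elim (g∤1 (measure-0⇒∣1 g∣f γ))
      factorise (suc N) {g} {k} k≤1+N g∣f g∤1 γ {m} {h} fac@(p , irr , h≈∏)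
        with irreducible⊎reducible g∤1
      ... | inj₁ g-irr =
        suc m , ℕ.+-monoˡ-≤ m (nonunit-measure g∣f g∤1 γ) ,
        g ∷ᵛ p , (λ { fzero → g-irr ; (fsuc i) → irr i }) , *-congˡ h≈∏
      ... | inj₂ (x , y , g≈xy , x∤1 , y∤1)
        with x∣f ← ∣-trans (∣-respʳ (sym g≈xy) (x∣xy x y)) g∣f
           | y∣f ← ∣-trans (∣-respʳ (sym g≈xy) (x∣ʳyx y x)) g∣f
        with i , ξ ← divisor-measure x∣f | j , η ← divisor-measure y∣f
        with ≡.refl ← unique γ (respects (sym g≈xy) (additive ξ η))
        -- `N` bounds the recursion: each of `x` and `y` has measure at least 1, which leaves at
        -- most `N` for the other. First `y * h` is factorised, then `x * (y * h)`.
        with m₁ , m₁≤ , fac₁ ← factorise N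
               (ℕ.+-cancelˡ-≤ 1 j N (ℕ.≤-trans (ℕ.+-monoˡ-≤ j (nonunit-measure x∣f x∤1 ξ)) k≤1+N))
               y∣f y∤1 η fac
        with m₂ , m₂≤ , p₂ , irr₂ , e₂ ← factorise N
               (ℕ.+-cancelʳ-≤ 1 i N (ℕ.≤-trans (ℕ.+-monoʳ-≤ i (nonunit-measure y∣f y∤1 η))
                 (ℕ.≤-trans k≤1+N (ℕ.≤-reflexive (ℕ.+-comm 1 N)))))
               x∣f x∤1 ξ fac₁ =
        m₂ , ℕ.≤-trans m₂≤ (ℕ.≤-trans (ℕ.+-monoʳ-≤ i m₁≤)
                                      (ℕ.≤-reflexive (≡.sym (ℕ.+-assoc i j m)))) ,
        p₂ , irr₂ , trans (*-congʳ g≈xy) (trans (*-assoc x y h) e₂)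

    productOfAtMost : ∀ {k} → 1 ≤ k → HasMeasure f k → ProductOfAtMost k f
    productOfAtMost {k} 1≤k μ
      -- Measure at least 1 makes `f` a nonunit; the accumulator starts as the empty factorisation
      -- of `1#`.
      with m , m≤ , p , irr , e ← factorise k ℕ.≤-refl ∣-refl
             (λ f∣1 → ℕ.<⇒≢ 1≤k (≡.sym (measure-unit f∣1 μ))) μ
             {0} {1#} ([]ᵛ , (λ ()) , refl) =
      (m , ℕ.≤-trans m≤ (ℕ.≤-reflexive (ℕ.+-identityʳ k)) ,
       p , irr , trans (sym (*-identityʳ f)) e) ,
      factor-count-≤ μ

-- Sums of monomials as coefficient lists.

module _ {c ℓ} (R : CommutativeRing c ℓ) where

  private
    module R = CommutativeRing R
  open Polynomial R
  open RawSemiringDefinitions (Semiring.rawSemiring (CommutativeRing.semiring commutativeRing))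
    using (sum; _^_)

  -- Horner's scheme: taking one factor `X` out of all later terms turns them into a shifted list.
  sum-monomials : ∀ {n} (a : Fin n → R.Carrier) →
    sum (λ i → C (a i) * X ^ toℕ i) ≈ tabulate a
  sum-monomials {zero}  a = ≈-refl
  sum-monomials {suc n} a = begin
    C (a fzero) * 1# + sum (λ i → C (a (fsuc i)) * (X * X ^ toℕ i))
      ≈⟨ F.+-cong (F.*-identityʳ (C (a fzero)))
                  (sum-cong-≋ λ i → x∙yz≈y∙xz (C (a (fsuc i))) X (X ^ toℕ i)) ⟩
    C (a fzero) + sum (λ i → X * (C (a (fsuc i)) * X ^ toℕ i))
      ≈⟨ F.+-congˡ {C (a fzero)} (*-distribˡ-sum X (λ i → C (a (fsuc i)) * X ^ toℕ i)) ⟨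
    C (a fzero) + X * sum (λ i → C (a (fsuc i)) * X ^ toℕ i)
      ≈⟨ F.+-congˡ {C (a fzero)} (F.*-congˡ {X} (sum-monomials (λ i → a (fsuc i)))) ⟩
    C (a fzero) + X * tabulate (λ i → a (fsuc i))
      ≈⟨ F.+-congˡ {C (a fzero)} (≈-trans (0∷-* 1# _) (∷-cong R.refl (*-identityˡ _))) ⟩
    C (a fzero) + (R.0# ∷ tabulate (λ i → a (fsuc i)))
      ≈⟨ ∷-cong (R.+-identityʳ (a fzero)) ≈-refl ⟩
    tabulate a ∎
    where
    module F = CommutativeRing commutativeRing
    open import Relation.Binary.Reasoning.Setoid setoid
    open import Algebra.Properties.Semiring.Sum F.semiring using (sum-cong-≋; *-distribˡ-sum)
    open import Algebra.Properties.CommutativeSemigroup F.*-commutativeSemigroup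
      using (x∙yz≈y∙xz)

  coeff-tabulate : ∀ {n} (a : Fin n → R.Carrier) i → coeff (tabulate a) (toℕ i) ≡ a i
  coeff-tabulate a fzero    = ≡.refl
  coeff-tabulate a (fsuc i) = coeff-tabulate (λ i → a (fsuc i)) i

  coeff-tabulate-≥ : ∀ {n} (a : Fin n → R.Carrier) {m} → n ≤ m → coeff (tabulate a) m ≡ R.0#
  coeff-tabulate-≥ {zero}  a z≤n       = ≡.refl
  coeff-tabulate-≥ {suc n} a (s≤s n≤m) = coeff-tabulate-≥ (λ i → a (fsuc i)) n≤m

-- From the dominance hypothesis to the excess of `f`.

v≤max-≢ : ∀ {m} (j : Fin m) (v : Fin m → ℤ ₋) {i} → i ≢ j →
          TotalOrder._≤_ ℤ₋-totalOrder (v i) (max-≢ j v)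
v≤max-≢ {m} j v {i} i≢j = All.lookup (Extrema.xs≤max ℤ₋-totalOrder ⊥₋ _)
  (∈-map⁺ v (∈-filter⁺ (λ i → ¬? (i Fin.≟ j)) (∈-allFin i) i≢j))

≮₋⊥₋ : ∀ {x y} → y ≡ ⊥₋ → ¬ x <₋ y
≮₋⊥₋ ≡.refl ()

-- `B` stands for 𝕂[x₁,...,x_{s-2}] and `A` for 𝕂[x₁,...,x_{s-1}], valued by the degree in x_{s-1};
-- `f` is a polynomial in x_s over `A`.
module Dominant {c ℓ} (em : ExcludedMiddle (c ⊔ ℓ)) (B : CommutativeRing c ℓ)
                (_≟_ : Decidable (CommutativeRing._≈_ B)) (nzd : NoZeroDivisors B) where

  private
    module B = CommutativeRing B
    module PB = Polynomial B
    module CB = Coefficients B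
    A = PB.commutativeRing
    module A = CommutativeRing A
    deg = PB.degree _≟_

    _≟ᴬ_ : Decidable A._≈_
    p ≟ᴬ q = lower-em c em

    nzdᴬ : NoZeroDivisors A
    nzdᴬ = CB.noZeroDivisors _≟_ nzd

    V : Valuation A ℓ
    V = CB.degreeValuation _≟_ nzd

  open Valuation V
  open Polynomial A
  open Coefficients A
  private
    module F = CommutativeRing commutativeRing
  open RawSemiringDefinitions (Semiring.rawSemiring F.semiring)
    using (sum; _^_; _∣_; Irreducible)
  open Factorisation commutativeRing using (ProductOfAtMost)

  private
    ∈-intro : ∀ {p n k} → CB.HasDegree p n → + n ℤ.≤ k → p ∈[ k ]
    ∈-intro d n≤k i k<i = d .CB.above≈0 i (ℤ.drop‿+<+ (ℤ.≤-<-trans n≤k k<i))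

    ∉-intro : ∀ {p n k} → CB.HasDegree p n → k ℤ.< + n → p ∉[ k ]
    ∉-intro d k<n h = d .CB.leading≉0 (h _ k<n)

  module _ {f n} (a : Fin (suc n) → A.Carrier)
    (f≈Σ : f ≈ sum (λ i → C (a i) * X ^ toℕ i))
    (a₀≉0 : ¬ a fzero A.≈ A.0#) (aₙ≉0 : ¬ a (fromℕ n) A.≈ A.0#) where

    private
      coeff-a : ∀ i → coeff f (toℕ i) A.≈ a i
      coeff-a i = A.trans (≈-trans f≈Σ (sum-monomials A a) .at (toℕ i))
                          (A.reflexive (coeff-tabulate A a i))

      coeff-above : ∀ {m} → n < m → coeff f m A.≈ A.0#
      coeff-above {m} n<m = A.trans (≈-trans f≈Σ (sum-monomials A a) .at m)
                                    (A.reflexive (coeff-tabulate-≥ A a n<m))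

      coeff-n : coeff f n A.≈ a (fromℕ n)
      coeff-n = ≡.subst (λ m → coeff f m A.≈ a (fromℕ n)) (Fin.toℕ-fromℕ n) (coeff-a (fromℕ n))

      f-degree : HasDegree f n
      f-degree = record
        { leading≉0 = λ z → aₙ≉0 (A.trans (A.sym coeff-n) z)
        ; above≈0   = λ _ → coeff-above
        }

    module _ (j : Fin (suc n)) {d} (dₙ : CB.HasDegree (a (fromℕ n)) d)
      (deg-aₙ : deg (a (fromℕ n)) ≡ [ + d ]) {y} (dⱼ : CB.HasDegree (a j) y)
      (deg-aⱼ : deg (a j) ≡ [ + y ])
      (dominant : max-≢ j (λ i → deg (a i) +₋ (+ toℕ j ℤ.- + toℕ i) ·₋ deg (a (fromℕ n)))
                  <₋ deg (a j)) where

      open Bottom A V (+ d)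

      private
        -- The weight of the term at index `j`, so that the level at that index is `y`.
        k : ℤ
        k = + y ℤ.- + toℕ j ℤ.* + d

        -- With `x` the degree of `a i`, dominance reads `x + (j - i) d < y`; adding `d i - j d` to
        -- both sides gives `x < k + d i`. A vanishing `a i` lies in every level.
        small : ∀ i → i ≢ j → a i ∈[ pred (k ℤ.+ + d ℤ.* + toℕ i) ]
        small i i≢j with CB.degree-spec _≟_ (a i)
        ... | inj₁ (_ , aᵢ≈0) = ∈-resp-≈ {k = pred (k ℤ.+ + d ℤ.* + toℕ i)} (A.sym aᵢ≈0)
                                         (0∈ {pred (k ℤ.+ + d ℤ.* + toℕ i)})
        ... | inj₂ (x , deg-aᵢ , dᵢ) = ∈-intro dᵢ (ℤ.i<j⇒i≤pred[j]
          (≡.subst₂ ℤ._<_ (lhs (+ x) (+ toℕ j) (+ toℕ i) (+ d))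
                          (rhs (+ y) (+ toℕ j) (+ toℕ i) (+ d))
            (ℤ.+-monoˡ-< (+ d ℤ.* + toℕ i ℤ.- + toℕ j ℤ.* + d) ([<]-injective
              (≡.subst₂ _<₋_ (≡.cong₂ (λ u v → u +₋ (+ toℕ j ℤ.- + toℕ i) ·₋ v) deg-aᵢ deg-aₙ)
                             deg-aⱼ
                (<₋-transʳ ℤ.≤-<-trans (v≤max-≢ j _ i≢j) dominant))))))
          where
          lhs : ∀ x j i d → x ℤ.+ (j ℤ.- i) ℤ.* d ℤ.+ (d ℤ.* i ℤ.- j ℤ.* d) ≡ x
          lhs = solve-∀
          rhs : ∀ y j i d → y ℤ.+ (d ℤ.* i ℤ.- j ℤ.* d) ≡ y ℤ.- j ℤ.* d ℤ.+ d ℤ.* i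
          rhs = solve-∀

        level-j : k ℤ.+ + d ℤ.* + toℕ j ≡ + y
        level-j = identity (+ y) (+ toℕ j) (+ d)
          where
          identity : ∀ y j d → y ℤ.- j ℤ.* d ℤ.+ d ℤ.* j ≡ y
          identity = solve-∀

        all-coeffs : ∀ {q} (Q : ℕ → A.Carrier → Set q) →
          (∀ {m p q} → p A.≈ q → Q m p → Q m q) → (∀ m → Q m A.0#) →
          (∀ i → Q (toℕ i) (a i)) → ∀ m → Q m (coeff f m)
        all-coeffs Q resp Q0 Qa m with m ℕ.<? suc n
        ... | no  m≮1+n = resp (A.sym (coeff-above (ℕ.≮⇒≥ m≮1+n))) (Q0 m)
        ... | yes m<1+n = ≡.subst (λ m → Q m (coeff f m)) (Fin.toℕ-fromℕ< m<1+n)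
          (resp (A.sym (coeff-a (fromℕ< m<1+n))) (Qa (fromℕ< m<1+n)))

      f-bottom : IsBottom f (toℕ j) k
      f-bottom = record
        { bound  = all-coeffs (λ m p → p ∈[ k ℤ.+ + d ℤ.* + m ])
            (λ {m} → ∈-resp-≈ {k = k ℤ.+ + d ℤ.* + m})
            (λ m → 0∈ {k ℤ.+ + d ℤ.* + m}) bound-a
        ; strict = all-coeffs (λ m p → m < toℕ j → p ∈[ pred (k ℤ.+ + d ℤ.* + m) ])
            (λ {m} e h m<j → ∈-resp-≈ {k = pred (k ℤ.+ + d ℤ.* + m)} e (h m<j))
            (λ m _ → 0∈ {pred (k ℤ.+ + d ℤ.* + m)})
            (λ i i<j → small i λ i≡j → ℕ.<⇒≢ i<j (≡.cong toℕ i≡j))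
        ; exact  = λ h → ∉-intro dⱼ (ℤ.i≤pred[j]⇒i<j (ℤ.pred-mono (ℤ.≤-reflexive level-j)))
            (∈-resp-≈ {k = pred (k ℤ.+ + d ℤ.* + toℕ j)} (coeff-a j) h)
        }
        where
        bound-a : ∀ i → a i ∈[ k ℤ.+ + d ℤ.* + toℕ i ]
        bound-a i with i Fin.≟ j
        ... | yes ≡.refl = ∈-intro dⱼ (ℤ.≤-reflexive (≡.sym level-j))
        ... | no  i≢j    = ∈-mono {a i} {pred (k ℤ.+ + d ℤ.* + toℕ i)}
          (ℤ.i≤j⇒pred[i]≤j ℤ.≤-refl) (small i i≢j)

    productOfAtMost : 2 ≤ n → (∀ {u} → ¬ u A.≈ A.0# → C u ∣ f → C u ∣ 1#) →
      (j : Fin (suc n)) → toℕ j ≤ n ∸ 1 →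
      max-≢ j (λ i → deg (a i) +₋ (+ toℕ j ℤ.- + toℕ i) ·₋ deg (a (fromℕ n))) <₋ deg (a j) →
      ProductOfAtMost (n ∸ toℕ j) f × (toℕ j ≡ n ∸ 1 → Irreducible f)
    productOfAtMost 2≤n units j j≤n∸1 dominant
      with CB.degree-spec _≟_ (a (fromℕ n)) | CB.degree-spec _≟_ (a j)
    ... | inj₁ (_ , aₙ≈0) | _ = ⊥-elim (aₙ≉0 aₙ≈0)
    -- Were `a j` zero, its degree would be -∞, and nothing is strictly below -∞.
    ... | inj₂ _ | inj₁ (deg-aⱼ , _) = ⊥-elim (≮₋⊥₋ deg-aⱼ dominant)
    ... | inj₂ (d , deg-aₙ , dₙ) | inj₂ (y , deg-aⱼ , dⱼ) =
      FC.productOfAtMost (ℕ.m<n⇒0<n∸m j<n) f-excess ,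
      λ j≡n∸1 → FC.measure-1⇒irreducible (≡.subst (HasExcess f)
        (≡.trans (≡.cong (n ∸_) j≡n∸1) (ℕ.m∸[m∸n]≡n 1≤n)) f-excess)
      where
      -- The slope is the degree of the leading coefficient, which puts that coefficient in level
      -- `w` as `excess-0⇒∣1` requires.
      open Excess A _≟ᴬ_ nzdᴬ V (+ d)
      1≤n : 1 ≤ n
      1≤n = ℕ.<⇒≤ 2≤n
      -- `1 ≤ n` makes the subtraction in `n ∸ 1` exact, so the bound on `j` becomes strict and the
      -- excess positive.
      j<n : toℕ j < n
      j<n = ℕ.≤-trans (s≤s j≤n∸1) (ℕ.≤-reflexive (ℕ.m+[n∸m]≡n 1≤n))
      f-excess : HasExcess f (n ∸ toℕ j)
      f-excess = n , toℕ j , _ , f-degree , f-bottom j dₙ deg-aₙ dⱼ deg-aⱼ dominant ,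
        ≡.sym (ℕ.m∸n+n≡m (ℕ.<⇒≤ j<n))
      -- Level -1 forces every coefficient to vanish.
      nonneg : ∀ {p} → ¬ p A.≈ A.0# → p ∉[ pred ℤ.0ℤ ]
      nonneg p≉0 h = p≉0 (PB.coeffwise λ i → h i ℤ.-<+)
      module FC = FactorCount.AdditiveMeasure commutativeRing em HasExcess
        hasExcess HasExcess-resp-≈ HasExcess-unique HasExcess-*
        (HasDegree⇒≉0 f-degree)
        (excess-0⇒∣1 f-degree
          (λ z → a₀≉0 (A.trans (A.sym (coeff-a fzero)) z))
          (∈-resp-≈ {k = + d} (A.sym coeff-n) (∈-intro dₙ ℤ.≤-refl))
          (ℤ.+≤+ z≤n) nonneg units)

-- Constants, their inverses, and the absence of zero divisors.

module Constants {c ℓ₁ ℓ₂} (em : ExcludedMiddle (c ⊔ ℓ₁ ⊔ ℓ₂)) (K : HeytingField c ℓ₁ ℓ₂) where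

  open Multivariate em K
  private
    module K = HeytingField K
    module KP = HeytingCommutativeRingProperties K.heytingCommutativeRing

    -- Tightness gives only the double negation of apartness, which excluded middle removes.
    ≉0⇒#0 : ∀ {k} → ¬ k K.≈ K.0# → k K.# K.0#
    ≉0⇒#0 {k} k≉0 = decidable-stable (lower-em (c ⊔ ℓ₁) em) λ ¬k#0 →
      k≉0 (proj₁ (K.tight k K.0#) ¬k#0)

  noZeroDivisorsᴷ : ∀ r → NoZeroDivisors 𝕂[x₁⋯x r ]
  noZeroDivisorsᴷ zero a≉0 b≉0 ab≈0 =
    K.#-irrefl ab≈0 (KP.x#0y#0→xy#0 (≉0⇒#0 a≉0) (≉0⇒#0 b≉0))
  noZeroDivisorsᴷ (suc r) =
    Coefficients.noZeroDivisors 𝕂[x₁⋯x r ] (λ _ _ → lower-em (c ⊔ ℓ₂) em) (noZeroDivisorsᴷ r)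

  constant-≈0 : ∀ r {k} → k K.≈ K.0# →
    CommutativeRing._≈_ 𝕂[x₁⋯x r ] (constant r k) (CommutativeRing.0# 𝕂[x₁⋯x r ])
  constant-≈0 zero    k≈0 = k≈0
  constant-≈0 (suc r) k≈0 = ≈-trans (∷-cong (constant-≈0 r k≈0) ≈-refl) 0∷0≈0
    where open Polynomial 𝕂[x₁⋯x r ]

  constant-inverse : ∀ r {k l} → l K.* k K.≈ K.1# →
    let open CommutativeRing 𝕂[x₁⋯x r ] in constant r l * constant r k ≈ 1#
  constant-inverse zero    lk≈1 = lk≈1
  constant-inverse (suc r) lk≈1 =
    ∷-cong (R.trans (R.+-identityʳ _) (constant-inverse r lk≈1)) ≈-refl
    where
    module R = CommutativeRing 𝕂[x₁⋯x r ]
    open Polynomial 𝕂[x₁⋯x r ]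

  inverse : ∀ {k} → ¬ k K.≈ K.0# → ∃[ l ] l K.* k K.≈ K.1#
  inverse k≉0 with l , e , _ ← K.#⇒invertible (≉0⇒#0 k≉0) =
    -- Apartness of `k` from 0 provides an inverse of the difference `k - 0`, which is then
    -- rewritten to `k`.
    l , K.trans (K.*-congˡ (K.sym (KP.x-0≈x _))) e

theorem10 : ∀ {c ℓ₁ ℓ₂} (em : ExcludedMiddle (c ⊔ ℓ₁ ⊔ ℓ₂)) (K : HeytingField c ℓ₁ ℓ₂) (t : ℕ) →
    let open Multivariate em K
        s = suc (suc (suc t))
        s-1 = suc (suc t)
        s-2 = suc t
        degₛ₋₁ = degLast s-2
        module A = CommutativeRing 𝕂[x₁⋯x s-1 ]
        module F = CommutativeRing 𝕂[x₁⋯x s ]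
        module D = RawSemiringDefinitions (Semiring.rawSemiring F.semiring)
        module P = Polynomial 𝕂[x₁⋯x s-1 ]
        open Factorisation 𝕂[x₁⋯x s ] using (ProductOfAtMost)
    in
    (f : Poly s) (n : ℕ) → 2 ≤ n →
    (a : Fin (suc n) → Poly s-1) →
    f F.≈ D.sum (λ i → P.C (a i) F.* P.X D.^ toℕ i) →
    ¬ (a fzero A.* a (fromℕ n) A.≈ A.0#) →
    ¬ (∃[ g ] (¬ IsConstant s-1 g × P.C g D.∣ f)) →
    (j : Fin (suc n)) → toℕ j ≤ n ∸ 1 →
    max-≢ j (λ i → degₛ₋₁ (a i) +₋ (+ toℕ j ℤ.- + toℕ i) ·₋ degₛ₋₁ (a (fromℕ n)))
      <₋ degₛ₋₁ (a j) →
    ProductOfAtMost (n ∸ toℕ j) f × (toℕ j ≡ n ∸ 1 → D.Irreducible f)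
theorem10 {c} {ℓ₁} {ℓ₂} em K t f n 2≤n a f≈Σ a₀aₙ≉0 no-factor j =
  Dominant.productOfAtMost (lower-em ℓ₂ em) 𝕂[x₁⋯x suc t ] _ (noZeroDivisorsᴷ (suc t))
    a f≈Σ
    (λ a₀≈0 → a₀aₙ≉0 (A.trans (A.*-congʳ {a (fromℕ n)} a₀≈0) (A.zeroˡ (a (fromℕ n)))))
    (λ aₙ≈0 → a₀aₙ≉0 (A.trans (A.*-congˡ {a fzero} aₙ≈0) (A.zeroʳ (a fzero))))
    2≤n units j
  where
  open Multivariate em K
  open Constants em K
  module A = CommutativeRing 𝕂[x₁⋯x suc (suc t) ]
  module F = CommutativeRing 𝕂[x₁⋯x suc (suc (suc t)) ]
  module P = Polynomial 𝕂[x₁⋯x suc (suc t) ]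
  open RawSemiringDefinitions (Semiring.rawSemiring F.semiring) using (_∣_)

  -- The assumption on factors free of x_s enters here: such a factor must be a constant, and the
  -- inverse of a nonzero constant in the field remains an inverse among polynomials.
  units : ∀ {u} → ¬ u A.≈ A.0# → P.C u ∣ f → P.C u ∣ P.1#
  units {u} u≉0 u∣f with lower-em ℓ₂ em {IsConstant (suc (suc t)) u}
  ... | no  ¬const      = ⊥-elim (no-factor (u , ¬const , u∣f))
  ... | yes (k , u≈k)
    with l , lk≈1 ← inverse {k} (λ k≈0 → u≉0 (A.trans u≈k (constant-≈0 (suc (suc t)) k≈0))) =
    constant (suc (suc (suc t))) l ,
    F.trans (F.*-congˡ {constant (suc (suc (suc t))) l} (P.∷-cong u≈k P.≈-refl))
            (constant-inverse (suc (suc (suc t))) lk≈1)
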